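{- Let $n$ be a positive integer. The following quantities are all equal: (i) the number of isomorphism classes of Steiner triple systems on $n$ points; (ii) the number of isomorphism classes of idempotent totally symmetric Latin squares of order $n$; (iii) the number of isotopism classes containing idempotent totally symmetric Latin squares of order $n$; (iv) the number of species containing idempotent totally symmetric Latin squares of order $n$; (v) the number of isomorphism classes of totally symmetric loops of order $n+1$; (vi) the number of isomorphism classes of totally symmetric unipotent Latin squares of order $n+1$; (vii) the number of isomorphism classes containing totally symmetric reduced Latin squares of order $n+1$; (viii) the number of isotopism classes containing totally symmetric unipotent Latin squares of order $n+1$; (ix) the number of isotopism classes containing totally symmetric reduced Latin squares of order $n+1$; (x) the number of species containing totally symmetric unipotent Latin squares of order $n+1$; (xi) the number of species containing totally symmetric reduced Latin squares of order $n+1$.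
   Context: A Latin square of order $m$ is a set of $m^2$ triples (row, column, symbol) over $\{1,\dots,m\}$, distinct triples agreeing in at most one coordinate; it is the operation table of a quasigroup, and a loop is a quasigroup with an identity element. The square (or quasigroup) is totally symmetric if it is unchanged by every uniform permutation of the three coordinates of its triples; reduced if its first row and column are $1,\dots,m$ in order; unipotent if all main diagonal entries are equal; idempotent if cell $(i,i)$ contains $i$ for all $i$. An isotopism $(\alpha,\beta,\gamma)\in\mathcal{S}_m^3$ maps $(r,c,s)$ to $(r^\alpha,c^\beta,s^\gamma)$; an isomorphism has $\alpha=\beta=\gamma$. A paratopism is an isotopism combined with a uniform permutation of the triple coordinates; species are paratopism classes. A class "containing" squares with a property means one containing at least one such square. A Steiner triple system on $n$ points is a collection of 3-element subsets (blocks) of an $n$-set such that every pair of points lies in exactly one block; two are isomorphic if a bijection of points maps blocks to blocks. -}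

module Defs where

open import Data.Nat using (ℕ; zero; suc)
open import Data.Unit using (⊤)
open import Data.Bool using (Bool; true)
open import Data.Fin using (Fin) renaming (zero to fzero; suc to fsuc)
open import Data.Fin.Subset using (Subset; _∈_; ∣_∣)
open import Data.Fin.Permutation using (Permutation′; _⟨$⟩ʳ_; _⟨$⟩ˡ_)
import Data.Fin.Permutation as Perm
open import Data.Vec using (tabulate; lookup)
open import Data.Product using (Σ; ∃; _×_)
open import Function.Bundles using (_⇔_)
open import Relation.Binary.PropositionalEquality using (_≡_; _≢_)

-- Counting equivalence classes meeting a property.
-- NumClasses P R k : there are exactly k classes of R that contain an
-- element satisfying P (given by k P-representatives, pairwise
-- R-inequivalent, such that every P-element is R-related to one of them).

NumClasses : {A : Set} → (A → Set) → (A → A → Set) → ℕ → Set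
NumClasses {A} P R k =
  Σ (Fin k → A) λ f →
    (∀ i → P (f i)) ×
    (∀ i j → R (f i) (f j) → i ≡ j) ×
    (∀ x → P x → ∃ λ i → R x (f i))

BlockFamily : ℕ → Set
BlockFamily n = Subset n → Bool

IsSTS : (n : ℕ) → BlockFamily n → Set
IsSTS n B =
  (∀ b → B b ≡ true → ∣ b ∣ ≡ 3) ×
  (∀ x y → x ≢ y →
     (∃ λ b → B b ≡ true × x ∈ b × y ∈ b) ×
     (∀ b b′ → B b ≡ true → x ∈ b → y ∈ b →
               B b′ ≡ true → x ∈ b′ → y ∈ b′ → b ≡ b′))

image : {n : ℕ} → Permutation′ n → Subset n → Subset n
image σ b = tabulate (λ j → lookup b (σ ⟨$⟩ˡ j))

STSIsomorphic : (n : ℕ) → BlockFamily n → BlockFamily n → Set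
STSIsomorphic n B B′ =
  Σ (Permutation′ n) λ σ → ∀ b → (B b ≡ true) ⇔ (B′ (image σ b) ≡ true)

Table : ℕ → Set
Table m = Fin m → Fin m → Fin m

IsLatin : (m : ℕ) → Table m → Set
IsLatin m L =
  (∀ r c c′ → L r c ≡ L r c′ → c ≡ c′) ×
  (∀ c r r′ → L r c ≡ L r′ c → r ≡ r′)

-- Triples (row, column, symbol) as functions Fin 3 → Fin m
-- (coordinate 0 = row, 1 = column, 2 = symbol).
Triple : ℕ → Set
Triple m = Fin 3 → Fin m

_∈T_ : {m : ℕ} → Triple m → Table m → Set
t ∈T L = L (t fzero) (t (fsuc fzero)) ≡ t (fsuc (fsuc fzero))

permuteCoords : {m : ℕ} → Permutation′ 3 → Triple m → Triple m
permuteCoords π t i = t (π ⟨$⟩ʳ i)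

applyIsotopism : {m : ℕ} → (Fin 3 → Permutation′ m) → Triple m → Triple m
applyIsotopism θ t i = θ i ⟨$⟩ʳ t i

MapsTo : (m : ℕ) → (Fin 3 → Permutation′ m) → Permutation′ 3 → Table m → Table m → Set
MapsTo m θ π L L′ = ∀ t → (t ∈T L) ⇔ (permuteCoords π (applyIsotopism θ t) ∈T L′)

Isomorphic : (m : ℕ) → Table m → Table m → Set
Isomorphic m L L′ = Σ (Permutation′ m) λ σ → MapsTo m (λ _ → σ) Perm.id L L′

Isotopic : (m : ℕ) → Table m → Table m → Set
Isotopic m L L′ = Σ (Fin 3 → Permutation′ m) λ θ → MapsTo m θ Perm.id L L′

Paratopic : (m : ℕ) → Table m → Table m → Set
Paratopic m L L′ =
  Σ (Fin 3 → Permutation′ m) λ θ → Σ (Permutation′ 3) λ π → MapsTo m θ π L L′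

-- Properties (Fin index zero plays the role of the symbol 1)

TotallySymmetric : (m : ℕ) → Table m → Set
TotallySymmetric m L = ∀ (π : Permutation′ 3) t → t ∈T L → permuteCoords π t ∈T L

-- (order 0 has no first row/column; only orders ≥ 1 are used)
Reduced : (m : ℕ) → Table m → Set
Reduced zero L = ⊤
Reduced (suc m) L = (∀ c → L fzero c ≡ c) × (∀ r → L r fzero ≡ r)

Unipotent : (m : ℕ) → Table m → Set
Unipotent m L = ∃ λ d → ∀ i → L i i ≡ d

Idempotent : (m : ℕ) → Table m → Set
Idempotent m L = ∀ i → L i i ≡ i

HasIdentity : (m : ℕ) → Table m → Set
HasIdentity m L = ∃ λ e → (∀ x → L e x ≡ x) × (∀ x → L x e ≡ x)

IdemTS : (m : ℕ) → Table m → Set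
IdemTS m L = IsLatin m L × TotallySymmetric m L × Idempotent m L

TSLoop : (m : ℕ) → Table m → Set
TSLoop m L = IsLatin m L × TotallySymmetric m L × HasIdentity m L

TSUnipotent : (m : ℕ) → Table m → Set
TSUnipotent m L = IsLatin m L × TotallySymmetric m L × Unipotent m L

TSReduced : (m : ℕ) → Table m → Set
TSReduced m L = IsLatin m L × TotallySymmetric m L × Reduced m L

{-# OPTIONS --safe #-}
-- A Latin square is totally symmetric exactly when its operation is commutative
-- and satisfies x(xy) = y.  Blocks of a Steiner triple system are the
-- three-element subsquares of the corresponding idempotent totally symmetric
-- square, and adjoining an identity to such a square (with all squares equal to
-- it) gives the totally symmetric reduced square of order n + 1.  The different
-- notions of equivalence coincide: paratopic totally symmetric squares are
-- isotopic, and an isotopism (α , β , γ) between two of them remains one after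
-- permuting its components.  In the idempotent case this forces α itself to be
-- an isomorphism; in the unipotent case x ↦ α(e)α(x) is one, because α(e) and
-- β(e) then lie in the nucleus of the target.
module Submission where

open import Defs
open import Data.Bool using (true)
open import Data.Fin using (Fin; zero; suc)
open import Data.Fin.Patterns using (0F; 1F; 2F)
open import Data.Fin.Permutation using (Permutation′; _⟨$⟩ʳ_; _⟨$⟩ˡ_; inverseˡ; inverseʳ; permutation; transpose; lift₀; remove; lift₀-remove; flip; _∘ₚ_)
import Data.Fin.Permutation as Perm
open import Data.Fin.Properties using (_≟_; suc-injective; all?)
open import Data.Fin.Subset using (Subset; _∈_; _∉_; ∣_∣; _-_; _∪_; ⁅_⁆; Nonempty; Empty; inside; outside)
open import Data.Fin.Subset.Properties using (_∈?_; nonempty?; Empty-unique; ∣⊥∣≡0; p─⊥≡p; p─q⊆p; x∈p∧x≢y⇒x∈p-y; x∈p∪q⁻; x∈p∪q⁺; x∈⁅x⁆; x∈⁅y⁆⇒x≡y; ⊆-antisym)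
open import Data.Nat using (ℕ; suc; _<_; _+_)
import Data.Nat.Properties as ℕ
open import Data.Product using (∃; _×_; _,_; proj₁; proj₂)
open import Data.Sum using (_⊎_; inj₁; inj₂)
open import Data.Vec using (_∷_; lookup; here; there)
open import Data.Vec.Properties using ([]=⇒lookup; lookup⇒[]=; lookup∘tabulate; tabulate∘lookup; tabulate-cong)
open import Function.Base using (_∘_; id)
open import Function.Bundles using (_⇔_; mk⇔; Equivalence)
open import Function.Construct.Composition using (_⇔-∘_)
open import Function.Construct.Identity using (⇔-id)
open import Function.Construct.Symmetry using (⇔-sym)
open import Relation.Binary.PropositionalEquality
open import Relation.Nullary using (Dec; yes; no; does; contradiction)
open import Relation.Nullary.Decidable using (_×-dec_; _→-dec_; dec-true)

open Equivalence using (to; from)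
open ≡-Reasoning

private
  variable
    A B : Set
    k m n : ℕ

-- Transporting counts of equivalence classes.

-- A count compares only elements with the property, so the two relations have to agree only there.
NumClasses-cong : {P Q : A → Set} {R S : A → A → Set} →
  (∀ x → P x ⇔ Q x) → (∀ x y → P x → P y → R x y ⇔ S x y) →
  NumClasses P R k ⇔ NumClasses Q S k
NumClasses-cong {P = P} {Q} {R} {S} PQ RS = mk⇔
  (λ (f , Pf , inj , sur) →
    f , (λ i → to (PQ _) (Pf i))
      , (λ i j s → inj i j (from (RS _ _ (Pf i) (Pf j)) s))
      , λ x q → let p = from (PQ x) q ; i , r = sur x p in
                i , to (RS _ _ p (Pf i)) r)
  (λ (f , Qf , inj , sur) → let Pf = λ i → from (PQ (f i)) (Qf i) in
    f , Pf
      , (λ i j r → inj i j (to (RS _ _ (Pf i) (Pf j)) r))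
      , λ x p → let i , s = sur x (to (PQ x) p) in
                i , from (RS _ _ p (Pf i)) s)

-- `F` acts like an equivalence of groupoids: `full` says that it preserves and reflects the
-- relation, `dense` that it is essentially surjective. Reasoning about `R` is carried out on the
-- side of `S`.
NumClasses-transfer : {P : A → Set} {R : A → A → Set} {Q : B → Set} {S : B → B → Set} →
  (∀ {x y} → S x y → S y x) → (∀ {x y z} → S x y → S y z → S x z) →
  (F : A → B) → (∀ {x} → P x → Q (F x)) →
  (∀ {x y} → P x → P y → R x y ⇔ S (F x) (F y)) →
  (∀ {y} → Q y → ∃ λ x → P x × S y (F x)) →
  NumClasses P R k ⇔ NumClasses Q S k
NumClasses-transfer S-sym S-trans F pres full dense = mk⇔
  (λ (f , Pf , inj , sur) →
    F ∘ f , (λ i → pres (Pf i))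
          , (λ i j s → inj i j (from (full (Pf i) (Pf j)) s))
          , λ y q → let x , p , s = dense q ; i , r = sur x p in
                    i , S-trans s (to (full p (Pf i)) r))
  (λ (g , Qg , inj , sur) →
    let x  = λ i → proj₁ (dense (Qg i))
        Px = λ i → proj₁ (proj₂ (dense (Qg i)))
        s  = λ i → proj₂ (proj₂ (dense (Qg i)))
    in x , Px
         , (λ i j r → inj i j (S-trans (s i) (S-trans (to (full (Px i) (Px j)) r) (S-sym (s j)))))
         , λ z p → let i , t = sur (F z) (pres p) in
                   i , from (full p (Px i)) (S-trans t (s i)))

-- Totally symmetric squares

⟨$⟩ʳ-injective : (σ : Permutation′ m) → ∀ {x y} → σ ⟨$⟩ʳ x ≡ σ ⟨$⟩ʳ y → x ≡ y
⟨$⟩ʳ-injective σ eq = trans (sym (inverseˡ σ)) (trans (cong (σ ⟨$⟩ˡ_) eq) (inverseˡ σ))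

record Sym (L : Table m) : Set where
  field
    comm  : ∀ x y → L x y ≡ L y x
    invol : ∀ x y → L x (L x y) ≡ y

  cancelˡ : ∀ x {y z} → L x y ≡ L x z → y ≡ z
  cancelˡ x {y} {z} e = trans (sym (invol x y)) (trans (cong (L x) e) (invol x z))

open Sym

triple : Fin m → Fin m → Fin m → Triple m
triple x y z 0F = x
triple x y z 1F = y
triple x y z 2F = z

TotallySymmetric⇒Sym : {L : Table m} → TotallySymmetric m L → Sym L
TotallySymmetric⇒Sym {L = L} ts = record
  { comm  = λ x y → sym (ts (transpose 0F 1F) (triple x y (L x y)) refl)
  ; invol = λ x y → ts (transpose 1F 2F) (triple x y (L x y)) refl
  }

-- Two adjacent transpositions generate all six orderings; the remaining clauses repeat an index.
rearrange : {T : A → A → A → Set} →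
  (∀ {x y z} → T x y z → T y x z) → (∀ {x y z} → T x y z → T x z y) →
  (t : Fin 3 → A) → T (t 0F) (t 1F) (t 2F) →
  ∀ i j k → i ≢ j → i ≢ k → j ≢ k → T (t i) (t j) (t k)
rearrange s₁ s₂ t p 0F 1F 2F _ _ _ = p
rearrange s₁ s₂ t p 0F 2F 1F _ _ _ = s₂ p
rearrange s₁ s₂ t p 1F 0F 2F _ _ _ = s₁ p
rearrange s₁ s₂ t p 1F 2F 0F _ _ _ = s₂ (s₁ p)
rearrange s₁ s₂ t p 2F 0F 1F _ _ _ = s₁ (s₂ p)
rearrange s₁ s₂ t p 2F 1F 0F _ _ _ = s₁ (s₂ (s₁ p))
rearrange s₁ s₂ t p 0F 0F _  a _ _ = contradiction refl a
rearrange s₁ s₂ t p 1F 1F _  a _ _ = contradiction refl a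
rearrange s₁ s₂ t p 2F 2F _  a _ _ = contradiction refl a
rearrange s₁ s₂ t p 0F 1F 0F _ b _ = contradiction refl b
rearrange s₁ s₂ t p 0F 2F 0F _ b _ = contradiction refl b
rearrange s₁ s₂ t p 1F 0F 1F _ b _ = contradiction refl b
rearrange s₁ s₂ t p 1F 2F 1F _ b _ = contradiction refl b
rearrange s₁ s₂ t p 2F 0F 2F _ b _ = contradiction refl b
rearrange s₁ s₂ t p 2F 1F 2F _ b _ = contradiction refl b
rearrange s₁ s₂ t p 0F 1F 1F _ _ c = contradiction refl c
rearrange s₁ s₂ t p 0F 2F 2F _ _ c = contradiction refl c
rearrange s₁ s₂ t p 1F 0F 0F _ _ c = contradiction refl c
rearrange s₁ s₂ t p 1F 2F 2F _ _ c = contradiction refl c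
rearrange s₁ s₂ t p 2F 0F 0F _ _ c = contradiction refl c
rearrange s₁ s₂ t p 2F 1F 1F _ _ c = contradiction refl c

Sym⇒TotallySymmetric : {L : Table m} → Sym L → TotallySymmetric m L
Sym⇒TotallySymmetric {L = L} S π t p =
  rearrange {T = λ x y z → L x y ≡ z}
    (λ {x} {y} e → trans (comm S y x) e)
    (λ {x} {y} e → trans (cong (L x) (sym e)) (invol S x y))
    t p _ _ _ (distinct λ ()) (distinct λ ()) (distinct λ ())
  where
  distinct : ∀ {i j} → i ≢ j → π ⟨$⟩ʳ i ≢ π ⟨$⟩ʳ j
  distinct i≢j = i≢j ∘ ⟨$⟩ʳ-injective π

-- Each row map is an involution, hence injective, and commutativity carries this over to columns.
Sym⇒IsLatin : {L : Table m} → Sym L → IsLatin m L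
Sym⇒IsLatin S =
  (λ r c c′ → cancelˡ S r) ,
  (λ c r r′ e → cancelˡ S c (trans (comm S c r) (trans e (comm S r′ c))))

module _ {L : Table m} (S : Sym L) where

  translation : Fin m → Permutation′ m
  translation a = permutation (L a) (L a) (invol S a) (invol S a)

  -- Multiplying by x turns xx = d into xd = x and back, since x(xy) = y. Hence totally symmetric
  -- unipotent squares and totally symmetric loops are the same squares.
  unipotent⇒identity : ∀ {d} → (∀ i → L i i ≡ d) → ∀ x → L d x ≡ x
  unipotent⇒identity {d} u x = begin
    L d x       ≡⟨ comm S d x ⟩
    L x d       ≡⟨ cong (L x) (u x) ⟨
    L x (L x x) ≡⟨ invol S x x ⟩
    x           ∎

  identity⇒unipotent : ∀ {e} → (∀ x → L e x ≡ x) → ∀ x → L x x ≡ e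
  identity⇒unipotent {e} l x = begin
    L x x       ≡⟨ cong (L x) (trans (sym (l x)) (comm S e x)) ⟩
    L x (L x e) ≡⟨ invol S x e ⟩
    e           ∎

-- Isotopisms

record Hom (α β γ : Permutation′ m) (L L′ : Table m) : Set where
  constructor hom
  field
    homo : ∀ x y → L′ (α ⟨$⟩ʳ x) (β ⟨$⟩ʳ y) ≡ γ ⟨$⟩ʳ L x y

open Hom

infix 4 _≅_

_≅_ : Table m → Table m → Set
L ≅ L′ = ∃ λ σ → Hom σ σ σ L L′

-- The triples (x, y, xy) give the equation; conversely, injectivity of the symbol permutation shows
-- that no further triple lands in `L′`.
MapsTo⇔Hom : (θ : Fin 3 → Permutation′ m) (L L′ : Table m) →
  MapsTo m θ Perm.id L L′ ⇔ Hom (θ 0F) (θ 1F) (θ 2F) L L′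
MapsTo⇔Hom θ L L′ = mk⇔
  (λ M → hom λ x y → to (M (triple x y (L x y))) refl)
  (λ h t → mk⇔
    (λ e → trans (homo h _ _) (cong (θ 2F ⟨$⟩ʳ_) e))
    (λ e → ⟨$⟩ʳ-injective (θ 2F) (trans (sym (homo h _ _)) e)))

Isomorphic⇔≅ : (L L′ : Table m) → Isomorphic m L L′ ⇔ L ≅ L′
Isomorphic⇔≅ L L′ = mk⇔
  (λ (σ , M) → σ , to (MapsTo⇔Hom (λ _ → σ) L L′) M)
  (λ (σ , h) → σ , from (MapsTo⇔Hom (λ _ → σ) L L′) h)

≅-sym : {L L′ : Table m} → L ≅ L′ → L′ ≅ L
≅-sym {L = L} {L′} (σ , h) = flip σ , hom λ x y → begin
  L (σ ⟨$⟩ˡ x) (σ ⟨$⟩ˡ y)                           ≡⟨ inverseˡ σ ⟨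
  σ ⟨$⟩ˡ (σ ⟨$⟩ʳ L (σ ⟨$⟩ˡ x) (σ ⟨$⟩ˡ y))           ≡⟨ cong (σ ⟨$⟩ˡ_) (homo h _ _) ⟨
  σ ⟨$⟩ˡ L′ (σ ⟨$⟩ʳ (σ ⟨$⟩ˡ x)) (σ ⟨$⟩ʳ (σ ⟨$⟩ˡ y)) ≡⟨ cong (σ ⟨$⟩ˡ_) (cong₂ L′ (inverseʳ σ) (inverseʳ σ)) ⟩
  σ ⟨$⟩ˡ L′ x y                                     ∎

≅-trans : {L L′ L″ : Table m} → L ≅ L′ → L′ ≅ L″ → L ≅ L″
≅-trans (σ , h) (τ , h′) = σ ∘ₚ τ , hom λ x y →
  trans (homo h′ _ _) (cong (τ ⟨$⟩ʳ_) (homo h x y))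

-- The permutation of coordinates is undone inside the target, which is invariant under its inverse;
-- the isotopism `θ` stays the same.
Paratopic⇒Isotopic : (L L′ : Table m) → TotallySymmetric m L′ → Paratopic m L L′ → Isotopic m L L′
Paratopic⇒Isotopic L L′ ts (θ , π , M) = θ , from (MapsTo⇔Hom θ L L′) (hom λ x y →
  let t = applyIsotopism θ (triple x y (L x y))
      e = λ i → cong t (inverseʳ π {i})
  in begin
  L′ (t 0F) (t 1F)
    ≡⟨ cong₂ L′ (e 0F) (e 1F) ⟨
  L′ (t (π ⟨$⟩ʳ (π ⟨$⟩ˡ 0F))) (t (π ⟨$⟩ʳ (π ⟨$⟩ˡ 1F)))
    ≡⟨ ts (flip π) (permuteCoords π t) (to (M (triple x y (L x y))) refl) ⟩
  t (π ⟨$⟩ʳ (π ⟨$⟩ˡ 2F))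
    ≡⟨ e 2F ⟩
  t 2F ∎)

module _ {L L′ : Table m} (S : Sym L) (S′ : Sym L′) {α β γ : Permutation′ m} where

  Hom-swap : Hom α β γ L L′ → Hom β α γ L L′
  Hom-swap h = hom λ x y →
    trans (comm S′ _ _) (trans (homo h y x) (cong (γ ⟨$⟩ʳ_) (comm S y x)))

  -- Multiplying by α(x) exchanges β(y) and γ(xy) in the equation. With `Hom-swap` this yields every
  -- ordering of the three components.
  Hom-rotate : Hom α β γ L L′ → Hom α γ β L L′
  Hom-rotate h = hom λ x y → let a = α ⟨$⟩ʳ x in begin
    L′ a (γ ⟨$⟩ʳ y)                 ≡⟨ cong (λ z → L′ a (γ ⟨$⟩ʳ z)) (invol S x y) ⟨
    L′ a (γ ⟨$⟩ʳ L x (L x y))       ≡⟨ cong (L′ a) (homo h _ _) ⟨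
    L′ a (L′ a (β ⟨$⟩ʳ L x y))      ≡⟨ invol S′ _ _ ⟩
    β ⟨$⟩ʳ L x y                    ∎

module _ {L L′ : Table m} (S : Sym L) (S′ : Sym L′)
         {α β γ : Permutation′ m} (ab→c : Hom α β γ L L′) where

  private
    infixl 7 _·_
    _·_ : Fin m → Fin m → Fin m
    _·_ = L′

    a b c : Fin m → Fin m
    a = α ⟨$⟩ʳ_
    b = β ⟨$⟩ʳ_
    c = γ ⟨$⟩ʳ_

    ba→c : Hom β α γ L L′
    ba→c = Hom-swap S S′ ab→c

    ac→b : Hom α γ β L L′
    ac→b = Hom-rotate S S′ ab→c

  -- Put δ = αβ⁻¹. Replacing `b` by `a` in a right factor costs an outer δ (`shift`), and
  -- idempotence gives γ = δα. Both sides of the isotopism equation then carry a δ, which cancels.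
  idempotent-Hom : Idempotent m L → Idempotent m L′ → Hom α α α L L′
  -- `flip β ∘ₚ α` is δ as a permutation, so it can be cancelled.
  idempotent-Hom idem idem′ = hom λ x y → ⟨$⟩ʳ-injective (flip β ∘ₚ α) (begin
    δ (a x · a y) ≡⟨ shift (a x) y ⟨
    a x · b y     ≡⟨ homo ab→c x y ⟩
    c (L x y)     ≡⟨ c≗δa (L x y) ⟩
    δ (a (L x y)) ∎)
    where
    δ : Fin m → Fin m
    δ w = a (β ⟨$⟩ˡ w)

    shift : ∀ u y → u · b y ≡ δ (u · a y)
    shift u y = begin
      u · b y           ≡⟨ comm S′ _ _ ⟩
      b y · u           ≡⟨ cong (b y ·_) u≡ ⟩
      b y · (b y · a s) ≡⟨ invol S′ _ _ ⟩
      a s               ∎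
      where
      s = β ⟨$⟩ˡ (u · a y)
      u≡ : u ≡ b y · a s
      -- Both orders of α and β send the pair (y, s) to γ(ys), which lets them trade places.
      u≡ = begin
        u                 ≡⟨ invol S′ (a y) u ⟨
        a y · (a y · u)   ≡⟨ cong (a y ·_) (comm S′ _ _) ⟩
        a y · (u · a y)   ≡⟨ cong (a y ·_) (inverseʳ β) ⟨
        a y · b s         ≡⟨ homo ab→c y s ⟩
        c (L y s)         ≡⟨ homo ba→c y s ⟨
        b y · a s         ∎

    c≗δa : ∀ z → c z ≡ δ (a z)
    c≗δa z = begin
      c z           ≡⟨ cong c (idem z) ⟨
      c (L z z)     ≡⟨ homo ab→c z z ⟨
      a z · b z     ≡⟨ shift (a z) z ⟩
      δ (a z · a z) ≡⟨ cong δ (idem′ (a z)) ⟩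
      δ (a z)       ∎

  -- Since e is an identity, multiplication by α(e) interchanges β(z) and γ(z). With u = α(x) and v
  -- = β(y), both sides therefore equal β(xy).
  nucleus : ∀ {e} → (∀ x → L e x ≡ x) → ∀ u v → u · (a e · v) ≡ a e · (u · v)
  nucleus {e} id-e u v = begin
    u · (a e · v)     ≡⟨ cong₂ (λ u v → u · (a e · v)) (inverseʳ α) (inverseʳ β) ⟨
    a x · (a e · b y) ≡⟨ cong (a x ·_) (trans (homo ab→c e y) (cong c (id-e y))) ⟩
    a x · c y         ≡⟨ homo ac→b x y ⟩
    b (L x y)         ≡⟨ trans (homo ac→b e (L x y)) (cong b (id-e _)) ⟨
    a e · c (L x y)   ≡⟨ cong (a e ·_) (homo ab→c x y) ⟨
    a e · (a x · b y) ≡⟨ cong₂ (λ u v → a e · (u · v)) (inverseʳ α) (inverseʳ β) ⟩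
    a e · (u · v)     ∎
    where
    x = α ⟨$⟩ˡ u
    y = β ⟨$⟩ˡ v

module _ {L L′ : Table m} (S : Sym L) (S′ : Sym L′)
         {α β γ : Permutation′ m} (ab→c : Hom α β γ L L′) where

  private
    infixl 7 _·_
    _·_ : Fin m → Fin m → Fin m
    _·_ = L′

    a b c : Fin m → Fin m
    a = α ⟨$⟩ʳ_
    b = β ⟨$⟩ʳ_
    c = γ ⟨$⟩ʳ_

    ba→c = Hom-swap S S′ ab→c
    ac→b = Hom-rotate S S′ ab→c
    bc→a = Hom-rotate S S′ ba→c

  -- The two factors α(e) come out of the product and cancel, leaving α(x)α(y). Writing α(y) =
  -- β(e)γ(y) and pulling out β(e) then leads to α(e)α(xy).
  loop-Hom : ∀ {e} → (∀ x → L e x ≡ x) → L ≅ L′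
  loop-Hom {e} id-e = α ∘ₚ translation S′ (a e) , (hom λ x y → begin
    a e · a x · (a e · a y)   ≡⟨ nuc-a (a e · a x) (a y) ⟩
    a e · (a e · a x · a y)   ≡⟨ cong (a e ·_) (comm S′ _ _) ⟩
    a e · (a y · (a e · a x)) ≡⟨ cong (a e ·_) (nuc-a (a y) (a x)) ⟩
    a e · (a e · (a y · a x)) ≡⟨ invol S′ _ _ ⟩
    a y · a x                 ≡⟨ comm S′ _ _ ⟩
    a x · a y                 ≡⟨ cong (a x ·_) (be·c y) ⟨
    a x · (b e · c y)         ≡⟨ nuc-b (a x) (c y) ⟩
    b e · (a x · c y)         ≡⟨ cong (b e ·_) (homo ac→b x y) ⟩
    b e · b (L x y)           ≡⟨ cong (b e ·_) (trans (homo ac→b e _) (cong b (id-e _))) ⟨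
    b e · (a e · c (L x y))   ≡⟨ nuc-a (b e) _ ⟩
    a e · (b e · c (L x y))   ≡⟨ cong (a e ·_) (be·c _) ⟩
    a e · a (L x y)           ∎)
    where
    nuc-a = nucleus S S′ ab→c id-e
    -- The swapped isotopism gives the same property for β(e).
    nuc-b = nucleus S S′ ba→c id-e

    be·c : ∀ y → b e · c y ≡ a y
    be·c y = trans (homo bc→a e y) (cong a (id-e y))

-- Reducing isotopy and paratopy to isomorphism.

module _ (P : Table m → Set) (k : ℕ) where

  isomorphism-classes : NumClasses P (Isomorphic m) k ⇔ NumClasses P _≅_ k
  isomorphism-classes = NumClasses-cong (λ _ → ⇔-id _) (λ L L′ _ _ → Isomorphic⇔≅ L L′)

  module _ (P⇒TS : ∀ {L} → P L → TotallySymmetric m L)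
           (Hom⇒≅ : ∀ {L L′ α β γ} → P L → P L′ → Hom α β γ L L′ → L ≅ L′) where

    private
      Isotopic⇒≅ : ∀ L L′ → P L → P L′ → Isotopic m L L′ → L ≅ L′
      Isotopic⇒≅ L L′ p p′ (θ , M) = Hom⇒≅ p p′ (to (MapsTo⇔Hom θ L L′) M)

      ≅⇒Isotopic : ∀ L L′ → L ≅ L′ → Isotopic m L L′
      ≅⇒Isotopic L L′ (σ , h) = (λ _ → σ) , from (MapsTo⇔Hom (λ _ → σ) L L′) h

    isotopism-classes : NumClasses P (Isotopic m) k ⇔ NumClasses P _≅_ k
    isotopism-classes = NumClasses-cong (λ _ → ⇔-id _)
      (λ L L′ p p′ → mk⇔ (Isotopic⇒≅ L L′ p p′) (≅⇒Isotopic L L′))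

    species : NumClasses P (Paratopic m) k ⇔ NumClasses P _≅_ k
    species = NumClasses-cong (λ _ → ⇔-id _)
      (λ L L′ p p′ → mk⇔
        (λ q → Isotopic⇒≅ L L′ p p′ (Paratopic⇒Isotopic L L′ (P⇒TS p′) q))
        (λ i → let θ , M = ≅⇒Isotopic L L′ i in θ , Perm.id , M))

-- Adjoining an identity

-- The Steiner loop construction: `zero` is the new identity and overwrites the diagonal.
extend : Table n → Table (suc n)
extend L zero    y       = y
extend L (suc i) zero    = suc i
extend L (suc i) (suc j) with i ≟ j
... | yes _ = zero
... | no  _ = suc (L i j)

module _ (L : Table n) where

  extend-diagonal : ∀ x → extend L x x ≡ zero
  extend-diagonal zero = refl
  extend-diagonal (suc i) with i ≟ i
  ... | yes _   = refl
  ... | no  i≢i = contradiction refl i≢i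

  extend-off-diagonal : ∀ {i j} → i ≢ j → extend L (suc i) (suc j) ≡ suc (L i j)
  extend-off-diagonal {i} {j} i≢j with i ≟ j
  ... | yes i≡j = contradiction i≡j i≢j
  ... | no  _   = refl

  extend-identityʳ : ∀ x → extend L x zero ≡ x
  extend-identityʳ zero    = refl
  extend-identityʳ (suc _) = refl

  module _ (S : Sym L) (idem : Idempotent n L) where

    -- Row i already has i on the diagonal. Hence the inner product in x(xy) leads to another
    -- off-diagonal cell, where `extend` still copies `L`.
    i≢Lij : ∀ {i j} → i ≢ j → i ≢ L i j
    i≢Lij {i} i≢j e = i≢j (cancelˡ S i (trans (idem i) e))

    extend-Sym : Sym (extend L)
    extend-Sym .comm zero    y       = sym (extend-identityʳ y)
    extend-Sym .comm (suc i) zero    = refl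
    extend-Sym .comm (suc i) (suc j) with i ≟ j
    ... | yes refl = sym (extend-diagonal (suc i))
    ... | no  i≢j  = trans (cong suc (comm S i j)) (sym (extend-off-diagonal (i≢j ∘ sym)))
    extend-Sym .invol zero    y       = refl
    extend-Sym .invol (suc i) zero    = extend-diagonal (suc i)
    extend-Sym .invol (suc i) (suc j) with i ≟ j
    ... | yes refl = refl
    ... | no  i≢j  = trans (extend-off-diagonal (i≢Lij i≢j)) (cong suc (invol S i j))

module _ {L L′ : Table n} (idem : Idempotent n L) (idem′ : Idempotent n L′) where

  extend-≅⁺ : L ≅ L′ → extend L ≅ extend L′
  extend-≅⁺ (σ , h) = lift₀ σ , hom lemma
    where
    lemma : ∀ x y → extend L′ (lift₀ σ ⟨$⟩ʳ x) (lift₀ σ ⟨$⟩ʳ y) ≡ lift₀ σ ⟨$⟩ʳ extend L x y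
    lemma zero    y       = refl
    lemma (suc i) zero    = refl
    lemma (suc i) (suc j) with i ≟ j
    ... | yes refl = extend-diagonal L′ (suc (σ ⟨$⟩ʳ i))
    ... | no  i≢j  = trans (extend-off-diagonal L′ (i≢j ∘ ⟨$⟩ʳ-injective σ)) (cong suc (homo h i j))

  -- An isomorphism fixes the identity and so restricts to the old elements; idempotence restores
  -- the diagonal that `extend` overwrote.
  extend-≅⁻ : extend L ≅ extend L′ → L ≅ L′
  extend-≅⁻ (τ , h) = σ , hom lemma
    where
    σ = remove zero τ

    τ0≡0 : τ ⟨$⟩ʳ zero ≡ zero
    -- The image of 0 = 00 is a square in the target, and all squares there are `zero`.
    τ0≡0 = trans (sym (homo h zero zero)) (extend-diagonal L′ (τ ⟨$⟩ʳ zero))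

    suc-σ : ∀ i → suc (σ ⟨$⟩ʳ i) ≡ τ ⟨$⟩ʳ suc i
    suc-σ i = lift₀-remove τ τ0≡0 (suc i)

    lemma : ∀ i j → L′ (σ ⟨$⟩ʳ i) (σ ⟨$⟩ʳ j) ≡ σ ⟨$⟩ʳ L i j
    lemma i j with i ≟ j
    ... | yes refl = trans (idem′ (σ ⟨$⟩ʳ i)) (cong (σ ⟨$⟩ʳ_) (sym (idem i)))
    ... | no  i≢j  = suc-injective (begin
      suc (L′ (σ ⟨$⟩ʳ i) (σ ⟨$⟩ʳ j))                    ≡⟨ extend-off-diagonal L′ (i≢j ∘ ⟨$⟩ʳ-injective σ) ⟨
      extend L′ (suc (σ ⟨$⟩ʳ i)) (suc (σ ⟨$⟩ʳ j))       ≡⟨ cong₂ (extend L′) (suc-σ i) (suc-σ j) ⟩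
      extend L′ (τ ⟨$⟩ʳ suc i) (τ ⟨$⟩ʳ suc j)           ≡⟨ homo h (suc i) (suc j) ⟩
      τ ⟨$⟩ʳ extend L (suc i) (suc j)                   ≡⟨ cong (τ ⟨$⟩ʳ_) (extend-off-diagonal L i≢j) ⟩
      τ ⟨$⟩ʳ suc (L i j)                                ≡⟨ suc-σ (L i j) ⟨
      suc (σ ⟨$⟩ʳ L i j)                                ∎)

predOr : Fin n → Fin (suc n) → Fin n
predOr d zero    = d
predOr d (suc i) = i

-- The default value of predOr is only reached on the diagonal, where it makes
-- the table idempotent.
restrict : Table (suc n) → Table n
restrict M i j = predOr i (M (suc i) (suc j))

module _ {M : Table (suc n)} (S : Sym M) (id-0 : ∀ x → M zero x ≡ x) where

  private
    M-diagonal : ∀ x → M x x ≡ zero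
    M-diagonal = identity⇒unipotent S id-0

    -- Each row has its `zero` on the diagonal and, by cancellation, nowhere else.
    M≡0⇒≡ : ∀ {i j} → M (suc i) (suc j) ≡ zero → i ≡ j
    M≡0⇒≡ {i} e = sym (suc-injective (cancelˡ S (suc i) (trans e (sym (M-diagonal (suc i))))))

  restrict-idempotent : Idempotent n (restrict M)
  restrict-idempotent i = cong (predOr i) (M-diagonal (suc i))

  restrict-Sym : Sym (restrict M)
  restrict-Sym .comm i j with M (suc i) (suc j) in eq
  ... | zero  = trans (M≡0⇒≡ eq) (sym (cong (predOr j) (trans (comm S (suc j) (suc i)) eq)))
  ... | suc _ = sym (cong (predOr j) (trans (comm S (suc j) (suc i)) eq))
  restrict-Sym .invol i j with M (suc i) (suc j) in eq
  ... | zero  = trans (restrict-idempotent i) (M≡0⇒≡ eq)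
  ... | suc _ = cong (predOr i) (trans (cong (M (suc i)) (sym eq)) (invol S (suc i) (suc j)))

  extend-restrict : M ≅ extend (restrict M)
  extend-restrict = Perm.id , hom lemma
    where
    lemma : ∀ x y → extend (restrict M) x y ≡ M x y
    lemma zero    y       = sym (id-0 y)
    lemma (suc i) zero    = sym (trans (comm S (suc i) zero) (id-0 (suc i)))
    lemma (suc i) (suc j) with i ≟ j | M (suc i) (suc j) in eq
    ... | yes refl | _     = trans (sym (M-diagonal (suc i))) eq
    ... | no  i≢j  | zero  = contradiction (M≡0⇒≡ eq) i≢j
    ... | no  _    | suc _ = cong (suc ∘ predOr i) eq

-- Relabelling a square.

transpose-sends : (i j : Fin m) → transpose i j ⟨$⟩ʳ i ≡ j
transpose-sends i j with i ≟ i
... | yes _   = refl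
... | no  i≢i = contradiction refl i≢i

-- Transport along the inverse of `σ`: the element `σ ⟨$⟩ʳ x` of `M` is renamed x.
conjugate : Permutation′ m → Table m → Table m
conjugate σ M x y = σ ⟨$⟩ˡ M (σ ⟨$⟩ʳ x) (σ ⟨$⟩ʳ y)

module _ (σ : Permutation′ m) {M : Table m} where

  conjugate-Sym : Sym M → Sym (conjugate σ M)
  conjugate-Sym S .comm x y = cong (σ ⟨$⟩ˡ_) (comm S _ _)
  conjugate-Sym S .invol x y = begin
    σ ⟨$⟩ˡ M s (σ ⟨$⟩ʳ (σ ⟨$⟩ˡ M s t)) ≡⟨ cong (λ z → σ ⟨$⟩ˡ M s z) (inverseʳ σ) ⟩
    σ ⟨$⟩ˡ M s (M s t)                 ≡⟨ cong (σ ⟨$⟩ˡ_) (invol S s t) ⟩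
    σ ⟨$⟩ˡ t                           ≡⟨ inverseˡ σ ⟩
    y                                  ∎
    where
    s = σ ⟨$⟩ʳ x
    t = σ ⟨$⟩ʳ y

  conjugate-≅ : M ≅ conjugate σ M
  conjugate-≅ = flip σ , hom λ x y → cong (σ ⟨$⟩ˡ_) (cong₂ M (inverseʳ σ) (inverseʳ σ))

-- Correspondences between idempotent, reduced, unipotent and loop squares.

IdemTS⇒Sym : {L : Table m} → IdemTS m L → Sym L
IdemTS⇒Sym (_ , ts , _) = TotallySymmetric⇒Sym ts

idem-Hom⇒≅ : {L L′ : Table m} {α β γ : Permutation′ m} → IdemTS m L → IdemTS m L′ → Hom α β γ L L′ → L ≅ L′
idem-Hom⇒≅ {α = α} p@(_ , _ , i) p′@(_ , _ , i′) h =
  α , idempotent-Hom (IdemTS⇒Sym p) (IdemTS⇒Sym p′) h i i′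

TSUnipotent⇒Sym : {L : Table m} → TSUnipotent m L → Sym L
TSUnipotent⇒Sym (_ , ts , _) = TotallySymmetric⇒Sym ts

unip-Hom⇒≅ : {L L′ : Table m} {α β γ : Permutation′ m} → TSUnipotent m L → TSUnipotent m L′ → Hom α β γ L L′ → L ≅ L′
unip-Hom⇒≅ p@(_ , _ , _ , u) p′ h =
  loop-Hom S (TSUnipotent⇒Sym p′) h (unipotent⇒identity S u)
  where S = TSUnipotent⇒Sym p

TSLoop⇔TSUnipotent : (L : Table m) → TSLoop m L ⇔ TSUnipotent m L
TSLoop⇔TSUnipotent L = mk⇔
  (λ (lat , ts , e , l , r) → lat , ts , e , identity⇒unipotent (TotallySymmetric⇒Sym ts) l)
  (λ (lat , ts , d , u) →
    let S = TotallySymmetric⇒Sym ts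
        l = unipotent⇒identity S u
    in lat , ts , d , l , λ x → trans (comm S x d) (l x))

TSReduced⇒TSUnipotent : {L : Table (suc n)} → TSReduced (suc n) L → TSUnipotent (suc n) L
TSReduced⇒TSUnipotent {L = L} (lat , ts , l , _) =
  lat , ts , zero , identity⇒unipotent (TotallySymmetric⇒Sym {L = L} ts) l

Sym⇒TSReduced : {L : Table (suc n)} → Sym L → (∀ x → L zero x ≡ x) → TSReduced (suc n) L
Sym⇒TSReduced S l =
  Sym⇒IsLatin S , Sym⇒TotallySymmetric S , l , λ x → trans (comm S x zero) (l x)

idempotent↔reduced : NumClasses (IdemTS n) _≅_ k ⇔ NumClasses (TSReduced (suc n)) _≅_ k
idempotent↔reduced = NumClasses-transfer ≅-sym ≅-trans extend
  (λ {L} p@(_ , _ , idem) → Sym⇒TSReduced (extend-Sym L (IdemTS⇒Sym p) idem) (λ _ → refl))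
  (λ (_ , _ , idem) (_ , _ , idem′) → mk⇔ (extend-≅⁺ idem idem′) (extend-≅⁻ idem idem′))
  (λ {M} (_ , ts , l , _) →
    let S = TotallySymmetric⇒Sym ts
        R = restrict-Sym S l
    in restrict M
     , (Sym⇒IsLatin R , Sym⇒TotallySymmetric R , restrict-idempotent S l)
     , extend-restrict S l)

-- The transfer map is the inclusion; exchanging the identity d with `zero` makes a unipotent square
-- reduced within its isomorphism class.
reduced↔unipotent : NumClasses (TSReduced (suc n)) _≅_ k ⇔ NumClasses (TSUnipotent (suc n)) _≅_ k
reduced↔unipotent = NumClasses-transfer ≅-sym ≅-trans id TSReduced⇒TSUnipotent (λ _ _ → ⇔-id _)
  (λ {M} p@(_ , _ , d , u) →
    let S = TSUnipotent⇒Sym p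
        σ = transpose zero d
    in conjugate σ M
     , Sym⇒TSReduced (conjugate-Sym σ S) (λ x → begin
         σ ⟨$⟩ˡ M (σ ⟨$⟩ʳ zero) (σ ⟨$⟩ʳ x) ≡⟨ cong (λ e → σ ⟨$⟩ˡ M e (σ ⟨$⟩ʳ x)) (transpose-sends zero d) ⟩
         σ ⟨$⟩ˡ M d (σ ⟨$⟩ʳ x)             ≡⟨ cong (σ ⟨$⟩ˡ_) (unipotent⇒identity S u _) ⟩
         σ ⟨$⟩ˡ (σ ⟨$⟩ʳ x)                 ≡⟨ inverseˡ σ ⟩
         x                                 ∎)
     , conjugate-≅ σ)

-- Three-element subsets

record Distinct (x y z : Fin n) : Set where
  constructor distinct
  field
    ≢₁₂ : x ≢ y
    ≢₁₃ : x ≢ z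
    ≢₂₃ : y ≢ z

record Contains (b : Subset n) (x y z : Fin n) : Set where
  constructor mem
  field
    ∈₁ : x ∈ b
    ∈₂ : y ∈ b
    ∈₃ : z ∈ b

∣p∣≡1+∣p-x∣ : {p : Subset n} {x : Fin n} → x ∈ p → ∣ p ∣ ≡ suc ∣ p - x ∣
∣p∣≡1+∣p-x∣ {p = inside ∷ p}  here      = cong (suc ∘ ∣_∣) (sym (p─⊥≡p p))
∣p∣≡1+∣p-x∣ {p = inside ∷ p}  (there q) = cong suc (∣p∣≡1+∣p-x∣ q)
∣p∣≡1+∣p-x∣ {p = outside ∷ p} (there q) = ∣p∣≡1+∣p-x∣ q

x∉p-x : (p : Subset n) (x : Fin n) → x ∉ p - x
x∉p-x (s ∷ p) zero    ()
x∉p-x (s ∷ p) (suc x) (there q) = x∉p-x p x q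

∈-⇒≢ : (p : Subset n) {x y : Fin n} → y ∈ p - x → x ≢ y
∈-⇒≢ p q refl = x∉p-x p _ q

∈-⇒∈ : (p : Subset n) {x y : Fin n} → y ∈ p - x → y ∈ p
∈-⇒∈ p {x} = p─q⊆p p ⁅ x ⁆

∣p∣≡1+k⇒Nonempty : (p : Subset n) → ∣ p ∣ ≡ suc k → Nonempty p
∣p∣≡1+k⇒Nonempty {n} p e with nonempty? p
... | yes q = q
... | no ¬q with () ← trans (sym e) (trans (cong ∣_∣ (Empty-unique ¬q)) (∣⊥∣≡0 n))

-- Used in both directions: in a set of size three nothing remains (`exhaust`), and if nothing
-- remains the size is three (`∣triple∣≡3`).
remove₃ : {b : Subset n} {x y z : Fin n} → Distinct x y z → Contains b x y z →
  ∣ b ∣ ≡ 3 + ∣ b - x - y - z ∣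
remove₃ (distinct x≢y x≢z y≢z) (mem x∈ y∈ z∈) =
  let y∈′ = x∈p∧x≢y⇒x∈p-y y∈ (x≢y ∘ sym)
      z∈′ = x∈p∧x≢y⇒x∈p-y (x∈p∧x≢y⇒x∈p-y z∈ (x≢z ∘ sym)) (y≢z ∘ sym)
  in trans (∣p∣≡1+∣p-x∣ x∈) (cong suc (trans (∣p∣≡1+∣p-x∣ y∈′) (cong suc (∣p∣≡1+∣p-x∣ z∈′))))

exhaust : {b : Subset n} {x y z : Fin n} → ∣ b ∣ ≡ 3 → Distinct x y z → Contains b x y z →
  ∀ {w} → w ∈ b → w ≡ x ⊎ w ≡ y ⊎ w ≡ z
exhaust {x = x} {y} {z} ∣b∣≡3 d e {w} w∈ with w ≟ x | w ≟ y | w ≟ z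
... | yes p | _     | _     = inj₁ p
... | no _  | yes p | _     = inj₂ (inj₁ p)
... | no _  | no _  | yes p = inj₂ (inj₂ p)
... | no w≢x | no w≢y | no w≢z
  with () ← trans (sym ∣b∣≡3) (trans (remove₃ d e) (cong (3 +_)
    (∣p∣≡1+∣p-x∣ (x∈p∧x≢y⇒x∈p-y (x∈p∧x≢y⇒x∈p-y (x∈p∧x≢y⇒x∈p-y w∈ w≢x) w≢y) w≢z))))

third-unique : {b : Subset n} {x y z w : Fin n} → ∣ b ∣ ≡ 3 → Distinct x y z → Contains b x y z →
  w ∈ b → x ≢ w → y ≢ w → w ≡ z
third-unique ∣b∣≡3 d e w∈ x≢w y≢w with exhaust ∣b∣≡3 d e w∈
... | inj₁ p        = contradiction (sym p) x≢w
... | inj₂ (inj₁ p) = contradiction (sym p) y≢w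
... | inj₂ (inj₂ p) = p

one-of-three : {P : Fin n → Set} {x y z w : Fin n} → P x → P y → P z → w ≡ x ⊎ w ≡ y ⊎ w ≡ z → P w
one-of-three px py pz (inj₁ refl)        = px
one-of-three px py pz (inj₂ (inj₁ refl)) = py
one-of-three px py pz (inj₂ (inj₂ refl)) = pz

triple-unique : {b b′ : Subset n} {x y z : Fin n} → ∣ b ∣ ≡ 3 → ∣ b′ ∣ ≡ 3 → Distinct x y z →
  Contains b x y z → Contains b′ x y z → b ≡ b′
triple-unique ∣b∣≡3 ∣b′∣≡3 d e@(mem p q r) e′@(mem p′ q′ r′) = ⊆-antisym
  (λ w∈ → one-of-three p′ q′ r′ (exhaust ∣b∣≡3 d e w∈))
  (λ w∈ → one-of-three p q r (exhaust ∣b′∣≡3 d e′ w∈))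

∣triple∣≡3 : {b : Subset n} {x y z : Fin n} → Distinct x y z → Contains b x y z →
  (∀ {w} → w ∈ b → w ≡ x ⊎ w ≡ y ⊎ w ≡ z) → ∣ b ∣ ≡ 3
∣triple∣≡3 {n} {b} {x} {y} {z} d e cover = trans (remove₃ d e) (cong (3 +_)
  (trans (cong ∣_∣ (Empty-unique empty)) (∣⊥∣≡0 n)))
  where
  empty : Empty (b - x - y - z)
  -- A remaining w would differ from all three points yet be one of them, giving w ≢ w.
  empty (w , w∈) = one-of-three {P = w ≢_}
    (∈-⇒≢ b (∈-⇒∈ (b - x) (∈-⇒∈ (b - x - y) w∈)) ∘ sym)
    (∈-⇒≢ (b - x) (∈-⇒∈ (b - x - y) w∈) ∘ sym)
    (∈-⇒≢ (b - x - y) w∈ ∘ sym)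
    (cover (∈-⇒∈ b (∈-⇒∈ (b - x) (∈-⇒∈ (b - x - y) w∈)))) refl

third : {b : Subset n} {x y : Fin n} → ∣ b ∣ ≡ 3 → x ≢ y → x ∈ b → y ∈ b →
  ∃ λ z → Distinct x y z × Contains b x y z
third {b = b} {x} {y} ∣b∣≡3 x≢y x∈ y∈ =
  let y∈′ = x∈p∧x≢y⇒x∈p-y y∈ (x≢y ∘ sym)
      z , z∈ = ∣p∣≡1+k⇒Nonempty (b - x - y) (ℕ.suc-injective (ℕ.suc-injective
        (trans (cong suc (sym (∣p∣≡1+∣p-x∣ y∈′))) (trans (sym (∣p∣≡1+∣p-x∣ x∈)) ∣b∣≡3))))
      z∈′ = ∈-⇒∈ (b - x) z∈
  in z , distinct x≢y (∈-⇒≢ b z∈′) (∈-⇒≢ (b - x) z∈) , mem x∈ y∈ (∈-⇒∈ b z∈′)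

points : (b : Subset n) → ∣ b ∣ ≡ 3 → ∃ λ x → ∃ λ y → ∃ λ z → Distinct x y z × Contains b x y z
points b ∣b∣≡3 =
  let x , x∈ = ∣p∣≡1+k⇒Nonempty b ∣b∣≡3
      y , y∈ = ∣p∣≡1+k⇒Nonempty (b - x) (ℕ.suc-injective (trans (sym (∣p∣≡1+∣p-x∣ x∈)) ∣b∣≡3))
  in x , y , third ∣b∣≡3 (∈-⇒≢ b y∈) x∈ (∈-⇒∈ b y∈)

line : Fin n → Fin n → Fin n → Subset n
line x y z = ⁅ x ⁆ ∪ (⁅ y ⁆ ∪ ⁅ z ⁆)

∈-line⁻ : (x y z : Fin n) {w : Fin n} → w ∈ line x y z → w ≡ x ⊎ w ≡ y ⊎ w ≡ z
∈-line⁻ x y z w∈ with x∈p∪q⁻ ⁅ x ⁆ _ w∈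
... | inj₁ p = inj₁ (x∈⁅y⁆⇒x≡y x p)
... | inj₂ q with x∈p∪q⁻ ⁅ y ⁆ _ q
...   | inj₁ p = inj₂ (inj₁ (x∈⁅y⁆⇒x≡y y p))
...   | inj₂ p = inj₂ (inj₂ (x∈⁅y⁆⇒x≡y z p))

∈-line⁺ : (x y z : Fin n) → Contains (line x y z) x y z
∈-line⁺ x y z = mem
  (x∈p∪q⁺ (inj₁ (x∈⁅x⁆ x)))
  (x∈p∪q⁺ {p = ⁅ x ⁆} (inj₂ (x∈p∪q⁺ (inj₁ (x∈⁅x⁆ y)))))
  (x∈p∪q⁺ {p = ⁅ x ⁆} (inj₂ (x∈p∪q⁺ {p = ⁅ y ⁆} (inj₂ (x∈⁅x⁆ z)))))

-- Images of subsets and isomorphism of block families.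

module _ (σ : Permutation′ n) where

  ∈-image⁺ : ∀ {b x} → x ∈ b → σ ⟨$⟩ʳ x ∈ image σ b
  ∈-image⁺ {b} {x} x∈ = lookup⇒[]= _ _ (begin
    lookup (image σ b) (σ ⟨$⟩ʳ x)     ≡⟨ lookup∘tabulate _ (σ ⟨$⟩ʳ x) ⟩
    lookup b (σ ⟨$⟩ˡ (σ ⟨$⟩ʳ x))      ≡⟨ cong (lookup b) (inverseˡ σ) ⟩
    lookup b x                        ≡⟨ []=⇒lookup x∈ ⟩
    inside                            ∎)

  ∈-image⁻ : ∀ {b x} → x ∈ image σ b → σ ⟨$⟩ˡ x ∈ b
  ∈-image⁻ {b} {x} x∈ = lookup⇒[]= _ _ (trans (sym (lookup∘tabulate _ x)) ([]=⇒lookup x∈))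

  -- The images of the three points are distinct and cover the image set.
  ∣image∣≡3 : ∀ {b} → ∣ b ∣ ≡ 3 → ∣ image σ b ∣ ≡ 3
  ∣image∣≡3 {b} ∣b∣≡3 with x , y , z , d@(distinct p q r) , e@(mem x∈ y∈ z∈) ← points b ∣b∣≡3 =
    ∣triple∣≡3
      (distinct (p ∘ ⟨$⟩ʳ-injective σ) (q ∘ ⟨$⟩ʳ-injective σ) (r ∘ ⟨$⟩ʳ-injective σ))
      (mem (∈-image⁺ x∈) (∈-image⁺ y∈) (∈-image⁺ z∈))
      (λ w∈ → cases (exhaust ∣b∣≡3 d e (∈-image⁻ w∈)))
    where
    move : ∀ {u v} → σ ⟨$⟩ˡ u ≡ v → u ≡ σ ⟨$⟩ʳ v
    move e = trans (sym (inverseʳ σ)) (cong (σ ⟨$⟩ʳ_) e)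
    cases : ∀ {x y z w} → σ ⟨$⟩ˡ w ≡ x ⊎ σ ⟨$⟩ˡ w ≡ y ⊎ σ ⟨$⟩ˡ w ≡ z →
      w ≡ σ ⟨$⟩ʳ x ⊎ w ≡ σ ⟨$⟩ʳ y ⊎ w ≡ σ ⟨$⟩ʳ z
    cases (inj₁ e)        = inj₁ (move e)
    cases (inj₂ (inj₁ e)) = inj₂ (inj₁ (move e))
    cases (inj₂ (inj₂ e)) = inj₂ (inj₂ (move e))

image-id : (b : Subset n) → image Perm.id b ≡ b
image-id = tabulate∘lookup

image-∘ : (σ τ : Permutation′ n) (b : Subset n) → image τ (image σ b) ≡ image (σ ∘ₚ τ) b
image-∘ σ τ b = tabulate-cong λ j → lookup∘tabulate _ (τ ⟨$⟩ˡ j)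

image-inverse : (σ : Permutation′ n) (b : Subset n) → image (flip σ) (image σ b) ≡ b
image-inverse σ b = trans (image-∘ σ (flip σ) b)
  (trans (tabulate-cong λ j → cong (lookup b) (inverseˡ σ)) (tabulate∘lookup b))

-- A record version of `STSIsomorphic`, from which the two families can be inferred.
record _≃_ (B B′ : BlockFamily n) : Set where
  constructor sts-iso
  field
    perm   : Permutation′ n
    blocks : ∀ b → (B b ≡ true) ⇔ (B′ (image perm b) ≡ true)

STSIsomorphic⇔≃ : (B B′ : BlockFamily n) → STSIsomorphic n B B′ ⇔ (B ≃ B′)
STSIsomorphic⇔≃ B B′ = mk⇔ (λ (σ , h) → sts-iso σ h) (λ (sts-iso σ h) → σ , h)

≃-sym : {B B′ : BlockFamily n} → B ≃ B′ → B′ ≃ B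
≃-sym {B = B} {B′} (sts-iso σ h) = sts-iso (flip σ) λ b → ⇔-sym (subst
  (λ c → (B (image (flip σ) b) ≡ true) ⇔ (B′ c ≡ true)) (image-inverse (flip σ) b) (h (image (flip σ) b)))

≃-trans : {B B′ B″ : BlockFamily n} → B ≃ B′ → B′ ≃ B″ → B ≃ B″
≃-trans {B″ = B″} (sts-iso σ h) (sts-iso τ h′) = sts-iso (σ ∘ₚ τ) λ b → subst
  (λ c → _ ⇔ (B″ c ≡ true)) (image-∘ σ τ b) (h′ (image σ b) ⇔-∘ h b)

-- Steiner triple systems

-- Closure under the product is decidable, as a Boolean family demands, and passes directly to
-- images under isomorphisms.
Block : Table n → Subset n → Set
Block L b = ∣ b ∣ ≡ 3 × (∀ x y → x ∈ b → y ∈ b → L x y ∈ b)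

block? : (L : Table n) (b : Subset n) → Dec (Block L b)
block? L b = (∣ b ∣ ℕ.≟ 3) ×-dec
  all? λ x → all? λ y → (x ∈? b) →-dec ((y ∈? b) →-dec (L x y ∈? b))

blockFamily : Table n → BlockFamily n
blockFamily L b = does (block? L b)

blockFamily⇔Block : (L : Table n) (b : Subset n) → (blockFamily L b ≡ true) ⇔ Block L b
blockFamily⇔Block L b = mk⇔ (sound (block? L b)) (dec-true (block? L b))
  where
  sound : ∀ {P : Set} (P? : Dec P) → does P? ≡ true → P
  sound (yes p) _ = p

module _ {L : Table n} (S : Sym L) (idem : Idempotent n L) where

  Distinct-product : ∀ {x y} → x ≢ y → Distinct x y (L x y)
  Distinct-product {x} {y} x≢y = distinct x≢y
    (i≢Lij L S idem x≢y)
    (λ e → i≢Lij L S idem (x≢y ∘ sym) (trans e (comm S x y)))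

  -- With z = xy, total symmetry gives xz = y and yz = x, and idempotence settles the squares: nine
  -- products in all.
  block-through : ∀ {x y} → x ≢ y → Block L (line x y (L x y))
  block-through {x} {y} x≢y =
    ∣triple∣≡3 (Distinct-product x≢y) m∈ (∈-line⁻ x y z) ,
    λ u v u∈ v∈ → one-of-three {P = λ u → L u v ∈ b}
      (one-of-three {P = λ v → L x v ∈ b} (is (idem x) x∈) z∈ (is (invol S x y) y∈) (∈-line⁻ x y z v∈))
      (one-of-three {P = λ v → L y v ∈ b} (is (comm S y x) z∈) (is (idem y) y∈) (is yz≡x x∈) (∈-line⁻ x y z v∈))
      (one-of-three {P = λ v → L z v ∈ b} (is (trans (comm S z x) (invol S x y)) y∈)
        (is (trans (comm S z y) yz≡x) x∈) (is (idem z) z∈) (∈-line⁻ x y z v∈))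
      (∈-line⁻ x y z u∈)
    where
    z = L x y
    b = line x y z
    m∈ = ∈-line⁺ x y z
    x∈ = Contains.∈₁ m∈
    y∈ = Contains.∈₂ m∈
    z∈ = Contains.∈₃ m∈
    is : ∀ {u v} → u ≡ v → v ∈ b → u ∈ b
    is refl q = q
    yz≡x : L y z ≡ x
    yz≡x = trans (cong (L y) (comm S x y)) (invol S y x)

  -- A closed three-set containing distinct x and y also contains xy, hence is determined by them.
  blockFamily-IsSTS : IsSTS n (blockFamily L)
  blockFamily-IsSTS =
    (λ b t → proj₁ (to (blockFamily⇔Block L b) t)) ,
    λ x y x≢y →
      (let mem x∈ y∈ _ = ∈-line⁺ x y (L x y) in
       line x y (L x y) , from (blockFamily⇔Block L _) (block-through x≢y) , x∈ , y∈) ,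
      λ b b′ t x∈ y∈ t′ x∈′ y∈′ →
        let c , cl = to (blockFamily⇔Block L b) t
            c′ , cl′ = to (blockFamily⇔Block L b′) t′
        in triple-unique c c′ (Distinct-product x≢y)
             (mem x∈ y∈ (cl x y x∈ y∈)) (mem x∈′ y∈′ (cl′ x y x∈′ y∈′))

Block-image : {L L′ : Table n} {σ : Permutation′ n} → Hom σ σ σ L L′ → ∀ {b} → Block L b → Block L′ (image σ b)
Block-image {L = L} {L′} {σ} h {b} (c , cl) = ∣image∣≡3 σ {b} c , λ x y x∈ y∈ →
  subst (_∈ image σ b)
    (trans (sym (homo h _ _)) (cong₂ L′ (inverseʳ σ) (inverseʳ σ)))
    (∈-image⁺ σ (cl _ _ (∈-image⁻ σ x∈) (∈-image⁻ σ y∈)))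

blockFamily-≅⁺ : {L L′ : Table n} → L ≅ L′ → blockFamily L ≃ blockFamily L′
blockFamily-≅⁺ {L = L} {L′} i@(σ , h) = sts-iso σ λ b → mk⇔
  (λ t → from (blockFamily⇔Block L′ _) (Block-image h (to (blockFamily⇔Block L b) t)))
  (λ t → from (blockFamily⇔Block L b) (subst (Block L) (image-inverse σ b)
    (Block-image (proj₂ (≅-sym i)) (to (blockFamily⇔Block L′ _) t))))

-- The image of the block {x, y, xy} is closed in `L′`, so the product of σ(x) and σ(y) lies in it
-- and can only be its third point σ(xy).
blockFamily-≅⁻ : {L L′ : Table n} → Sym L → Idempotent n L → Sym L′ → Idempotent n L′ →
  blockFamily L ≃ blockFamily L′ → L ≅ L′
blockFamily-≅⁻ {L = L} {L′} S idem S′ idem′ (sts-iso σ h) = σ , hom lemma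
  where
  lemma : ∀ x y → L′ (σ ⟨$⟩ʳ x) (σ ⟨$⟩ʳ y) ≡ σ ⟨$⟩ʳ L x y
  lemma x y with x ≟ y
  ... | yes refl = trans (idem′ _) (cong (σ ⟨$⟩ʳ_) (sym (idem x)))
  ... | no x≢y =
    let b = line x y (L x y)
        mem x∈ y∈ z∈ = ∈-line⁺ x y (L x y)
        c , cl = to (blockFamily⇔Block L′ (image σ b))
          (to (h b) (from (blockFamily⇔Block L b) (block-through S idem x≢y)))
        distinct _ x≢z y≢z = Distinct-product S idem x≢y
        distinct σx≢σy σx≢w σy≢w = Distinct-product S′ idem′ (x≢y ∘ ⟨$⟩ʳ-injective σ)
    in third-unique c
         (distinct σx≢σy (x≢z ∘ ⟨$⟩ʳ-injective σ) (y≢z ∘ ⟨$⟩ʳ-injective σ))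
         (mem (∈-image⁺ σ x∈) (∈-image⁺ σ y∈) (∈-image⁺ σ z∈))
         (cl _ _ (∈-image⁺ σ x∈) (∈-image⁺ σ y∈)) σx≢w σy≢w

module _ (B : BlockFamily n) (sts : IsSTS n B) where

  private
    card : ∀ {b} → B b ≡ true → ∣ b ∣ ≡ 3
    card = proj₁ sts _

  -- The graph of the product to be built, symmetric in its three arguments; `point` supplies the
  -- idempotent diagonal. Once the graph is functional, the laws of the product follow from this
  -- symmetry.
  data Collinear : Fin n → Fin n → Fin n → Set where
    point : ∀ {x} → Collinear x x x
    block : ∀ {x y z} b → B b ≡ true → Distinct x y z → Contains b x y z → Collinear x y z

  Collinear-swap : ∀ {x y z} → Collinear x y z → Collinear y x z
  Collinear-swap point = point
  Collinear-swap (block b t (distinct p q r) (mem x∈ y∈ z∈)) =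
    block b t (distinct (p ∘ sym) r q) (mem y∈ x∈ z∈)

  Collinear-rotate : ∀ {x y z} → Collinear x y z → Collinear x z y
  Collinear-rotate point = point
  Collinear-rotate (block b t (distinct p q r) (mem x∈ y∈ z∈)) =
    block b t (distinct q p (r ∘ sym)) (mem x∈ z∈ y∈)

  Collinear-total : ∀ x y → ∃ (Collinear x y)
  Collinear-total x y with x ≟ y
  ... | yes refl = x , point
  ... | no x≢y =
    let b , t , x∈ , y∈ = proj₁ (proj₂ sts x y x≢y)
        z , d , e = third (card t) x≢y x∈ y∈
    in z , block b t d e

  -- Two blocks through distinct x and y coincide, and a three-set has one third point.
  Collinear-functional : ∀ {x y z z′} → Collinear x y z → Collinear x y z′ → z ≡ z′
  Collinear-functional point point = refl
  Collinear-functional point (block _ _ (distinct p _ _) _) = contradiction refl p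
  Collinear-functional (block _ _ (distinct p _ _) _) point = contradiction refl p
  Collinear-functional (block b t d@(distinct p q r) (mem x∈ y∈ z∈)) (block b′ t′ d′ e′@(mem x∈′ y∈′ _))
    with refl ← proj₂ (proj₂ sts _ _ p) b b′ t x∈ y∈ t′ x∈′ y∈′ =
    third-unique (card t) d′ e′ z∈ q r

  steiner : Table n
  steiner x y = proj₁ (Collinear-total x y)

  private
    collinear : ∀ x y → Collinear x y (steiner x y)
    collinear x y = proj₂ (Collinear-total x y)

  steiner-Sym : Sym steiner
  steiner-Sym .comm x y = Collinear-functional (Collinear-swap (collinear x y)) (collinear y x)
  steiner-Sym .invol x y = Collinear-functional (collinear x _) (Collinear-rotate (collinear x y))

  steiner-idempotent : Idempotent n steiner
  steiner-idempotent x = Collinear-functional (collinear x x) point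

  B⇒Block : ∀ b → B b ≡ true → Block steiner b
  B⇒Block b t = card t , λ x y x∈ y∈ → closed x∈ y∈ (collinear x y)
    where
    closed : ∀ {x y z} → x ∈ b → y ∈ b → Collinear x y z → z ∈ b
    closed x∈ _ point = x∈
    closed x∈ y∈ (block b′ t′ (distinct p _ _) (mem x∈′ y∈′ z∈′)) =
      subst (_ ∈_) (proj₂ (proj₂ sts _ _ p) b′ b t′ x∈′ y∈′ t x∈ y∈) z∈′

  -- Two points x ≠ y of a closed three-set bring in their product; the block of `B` through x and y
  -- has the same three points.
  Block⇒B : ∀ b → Block steiner b → B b ≡ true
  Block⇒B b (c , cl) with x , y , _ , distinct x≢y _ _ , mem x∈ y∈ _ ← points b c =
    on-line x≢y x∈ y∈ (cl x y x∈ y∈) (collinear x y)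
    where
    on-line : ∀ {x y z} → x ≢ y → x ∈ b → y ∈ b → z ∈ b → Collinear x y z → B b ≡ true
    on-line x≢y _ _ _ point = contradiction refl x≢y
    on-line x≢y x∈ y∈ z∈ (block b′ t d e) =
      trans (cong B (triple-unique c (card t) d (mem x∈ y∈ z∈) e)) t

  blockFamily-steiner : B ≃ blockFamily steiner
  blockFamily-steiner = sts-iso Perm.id λ b → subst
    (λ c → (B b ≡ true) ⇔ (blockFamily steiner c ≡ true)) (sym (image-id b))
    (⇔-sym (blockFamily⇔Block steiner b) ⇔-∘ mk⇔ (B⇒Block b) (Block⇒B b))

idempotent↔STS : NumClasses (IdemTS n) _≅_ k ⇔ NumClasses (IsSTS n) (STSIsomorphic n) k
idempotent↔STS {n} = NumClasses-cong (λ _ → ⇔-id _) (λ B B′ _ _ → ⇔-sym (STSIsomorphic⇔≃ B B′)) ⇔-∘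
  NumClasses-transfer ≃-sym ≃-trans blockFamily
    (λ p@(_ , _ , idem) → blockFamily-IsSTS (IdemTS⇒Sym p) idem)
    (λ p@(_ , _ , idem) p′@(_ , _ , idem′) →
      mk⇔ blockFamily-≅⁺ (blockFamily-≅⁻ (IdemTS⇒Sym p) idem (IdemTS⇒Sym p′) idem′))
    (λ {B} sts → let S = steiner-Sym B sts in
      steiner B sts
      , (Sym⇒IsLatin S , Sym⇒TotallySymmetric S , steiner-idempotent B sts)
      , blockFamily-steiner B sts)

theorem17 : (n : ℕ) → 0 < n → (k : ℕ) →
    let c1 = NumClasses (IsSTS n) (STSIsomorphic n) k in
    (NumClasses (IdemTS n) (Isomorphic n) k ⇔ c1) ×
    (NumClasses (IdemTS n) (Isotopic n) k ⇔ c1) ×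
    (NumClasses (IdemTS n) (Paratopic n) k ⇔ c1) ×
    (NumClasses (TSLoop (suc n)) (Isomorphic (suc n)) k ⇔ c1) ×
    (NumClasses (TSUnipotent (suc n)) (Isomorphic (suc n)) k ⇔ c1) ×
    (NumClasses (TSReduced (suc n)) (Isomorphic (suc n)) k ⇔ c1) ×
    (NumClasses (TSUnipotent (suc n)) (Isotopic (suc n)) k ⇔ c1) ×
    (NumClasses (TSReduced (suc n)) (Isotopic (suc n)) k ⇔ c1) ×
    (NumClasses (TSUnipotent (suc n)) (Paratopic (suc n)) k ⇔ c1) ×
    (NumClasses (TSReduced (suc n)) (Paratopic (suc n)) k ⇔ c1)
theorem17 n _ k =
  idempotent↔STS ⇔-∘ isomorphism-classes (IdemTS n) k ,
  idempotent↔STS ⇔-∘ isotopism-classes (IdemTS n) k (proj₁ ∘ proj₂) idem-Hom⇒≅ ,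
  idempotent↔STS ⇔-∘ species (IdemTS n) k (proj₁ ∘ proj₂) idem-Hom⇒≅ ,
  -- Loops and unipotent squares are the same tables here, compared by the same relation.
  unipotent↔STS ⇔-∘ (isomorphism-classes Unip k ⇔-∘
    NumClasses-cong {R = Isomorphic (suc n)} TSLoop⇔TSUnipotent (λ _ _ _ _ → ⇔-id _)) ,
  unipotent↔STS ⇔-∘ isomorphism-classes Unip k ,
  reduced↔STS ⇔-∘ isomorphism-classes Red k ,
  unipotent↔STS ⇔-∘ isotopism-classes Unip k (proj₁ ∘ proj₂) unip-Hom⇒≅ ,
  reduced↔STS ⇔-∘ isotopism-classes Red k (proj₁ ∘ proj₂) red-Hom⇒≅ ,
  unipotent↔STS ⇔-∘ species Unip k (proj₁ ∘ proj₂) unip-Hom⇒≅ ,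
  reduced↔STS ⇔-∘ species Red k (proj₁ ∘ proj₂) red-Hom⇒≅
  where
  Unip = TSUnipotent (suc n)
  Red  = TSReduced (suc n)

  red-Hom⇒≅ : {L L′ : Table (suc n)} {α β γ : Permutation′ (suc n)} → Red L → Red L′ → Hom α β γ L L′ → L ≅ L′
  red-Hom⇒≅ p p′ = unip-Hom⇒≅ (TSReduced⇒TSUnipotent p) (TSReduced⇒TSUnipotent p′)

  reduced↔STS : NumClasses Red _≅_ k ⇔ NumClasses (IsSTS n) (STSIsomorphic n) k
  reduced↔STS = idempotent↔STS ⇔-∘ ⇔-sym idempotent↔reduced

  unipotent↔STS : NumClasses Unip _≅_ k ⇔ NumClasses (IsSTS n) (STSIsomorphic n) k
  unipotent↔STS = reduced↔STS ⇔-∘ ⇔-sym reduced↔unipotent
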